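{- The generating function $$G_{(213,231)}(x,p,q,y,z)=\sum_{n\ge 0}\ \sum_{\pi\in S_n(213,231)} x^n p^{\operatorname{asc}(\pi)} q^{\operatorname{des}(\pi)} y^{\operatorname{MNA}(\pi)} z^{\operatorname{MND}(\pi)}$$ is equal to $$\frac{1 + x + p x^2 y - p^2 x^2 y + q x^2 z - q^2 x^2 z - p q x^2 y z + p q x^3 y z - p^2 q x^3 y z - p q^2 x^3 y z}{1 - p^2 x^2 y - q^2 x^2 z - p q x^2 y z - p^2 q x^3 y z - p q^2 x^3 y z}.$$
   Context: For $n\ge 0$, $S_n$ denotes the set of permutations $\pi=\pi_1\pi_2\cdots\pi_n$ of $[n]=\{1,\dots,n\}$ ($S_0$ consists of the empty permutation, for which all statistics below are $0$). A permutation $\pi\in S_n$ avoids a pattern $\tau\in S_k$ if there are no indices $i_1<\dots<i_k$ such that $\pi_{i_a}<\pi_{i_b}$ if and only if $\tau_a<\tau_b$; $S_n(\tau,\rho)$ is the set of permutations in $S_n$ avoiding both $\tau$ and $\rho$. $\operatorname{asc}(\pi)$ (resp. $\operatorname{des}(\pi)$) is the number of $i\in[n-1]$ with $\pi_i<\pi_{i+1}$ (resp. $\pi_i>\pi_{i+1}$). $\operatorname{MNA}(\pi)$ is the maximum size of a set $I\subseteq[n-1]$ such that $\pi_i<\pi_{i+1}$ for all $i\in I$ and $|i-j|\ge 2$ for distinct $i,j\in I$; $\operatorname{MND}(\pi)$ is defined analogously with $\pi_i>\pi_{i+1}$. -}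

module Defs where

open import Algebra.Bundles using (CommutativeRing)
import Algebra.Properties.Semiring.Exp as Exp
open import Data.Bool.Base using (true; false)
open import Data.Fin.Base as Fin using (Fin; zero; suc; toℕ; inject₁)
open import Data.Fin.Patterns using (0F; 1F; 2F)
import Data.Fin.Properties as Fin
open import Data.Fin.Subset using (Subset; _∈_; ∣_∣)
open import Data.Fin.Subset.Properties using (_∈?_; _⊆?_)
open import Data.Integer.Properties using (+-*-commutativeRing)
open import Data.List.Base as List
  using (List; []; _∷_; allFin; cartesianProductWith; filter; foldr)
open import Data.List.Extrema.Nat using (max)
open import Data.Nat.Base as ℕ using (ℕ; zero; suc; pred; _∸_; ∣_-_∣)
import Data.Nat.Properties as ℕ
open import Data.Product.Base using (∃; _×_; _,_; uncurry; <_,_>)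
open import Data.Vec.Base using (Vec; []; _∷_; lookup; tabulate)
open import Data.Vec.Relation.Unary.AllPairs using (allPairs?)
open import Data.Vec.Relation.Unary.Unique.Propositional using (Unique)
open import Function.Base using (_∘_)
open import Function.Bundles using (_⇔_; mk⇔; Equivalence)
open import Level using (Level; 0ℓ)
open import Relation.Binary.PropositionalEquality using (_≢_)
open import Relation.Nullary using (¬_)
open import Relation.Nullary.Decidable
  using (Dec; does; map′; ¬?; _×-dec_; _→-dec_)
open import Relation.Unary using (Pred; Decidable)

private
  variable
    a c ℓ : Level
    A B : Set a
    k m n : ℕ

module PowerSeries (R : CommutativeRing c ℓ) where

  open CommutativeRing R
  open import Algebra.Properties.Semiring.Sum semiring
    using (sum⁺-syntax; sum-cong-≋; ∑-distrib-+; *-distribˡ-sum)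
  open import Relation.Binary.Reasoning.Setoid setoid

  Sequence : Set c
  Sequence = ℕ → Carrier

  infix  4 _≗_ _≋_
  infixl 6 _⊕_ _⊞_
  infixl 7 _⊛_ _⊠_

  _≗_ : Sequence → Sequence → Set ℓ
  f ≗ g = ∀ n → f n ≈ g n

  _⊕_ : Sequence → Sequence → Sequence
  (f ⊕ g) n = f n + g n

  _⊛_ : Sequence → Sequence → Sequence
  (f ⊛ g) n = ∑[ i ≤ n ] (f (toℕ i) * g (n ∸ toℕ i))

  constant : Carrier → Sequence
  constant r zero    = r
  constant r (suc _) = 0#

  -- Records without η keep conversion checking from unfolding series to their
  -- coefficients, which is very slow for the nested rings of series below.
  record Series : Set c where
    no-eta-equality
    field coeff : Sequence

  open Series public

  record _≋_ (f g : Series) : Set ℓ where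
    no-eta-equality
    constructor mk≋
    field coeff-≈ : coeff f ≗ coeff g

  open _≋_ public

  _⊞_ _⊠_ : Series → Series → Series
  coeff (f ⊞ g) = coeff f ⊕ coeff g
  coeff (f ⊠ g) = coeff f ⊛ coeff g

  ⊟_ : Series → Series
  coeff (⊟ f) n = - coeff f n

  const : Carrier → Series
  coeff (const r) = constant r

  X : Series
  coeff X zero    = 0#
  coeff X (suc n) = constant 1# n

  private

    tail : Sequence → Sequence
    tail f n = f (suc n)

    infixr 7 _·_

    _·_ : Carrier → Sequence → Sequence
    (r · f) n = r * f n

    ⊛-cong : ∀ {f f′ g g′} → f ≗ f′ → g ≗ g′ → f ⊛ g ≗ f′ ⊛ g′
    ⊛-cong f≗f′ g≗g′ n =
      sum-cong-≋ {suc n} (λ i → *-cong (f≗f′ (toℕ i)) (g≗g′ (n ∸ toℕ i)))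

    ⊛-distribˡ : ∀ f g h → f ⊛ (g ⊕ h) ≗ f ⊛ g ⊕ f ⊛ h
    ⊛-distribˡ f g h n = trans
      (sum-cong-≋ {suc n} (λ i → distribˡ (f (toℕ i)) (g (n ∸ toℕ i)) (h (n ∸ toℕ i))))
      (∑-distrib-+ {suc n} (λ i → f (toℕ i) * g (n ∸ toℕ i))
                           (λ i → f (toℕ i) * h (n ∸ toℕ i)))

    ⊛-suc′ : ∀ f g n → (f ⊛ g) (suc n) ≈ (f ⊛ tail g) n + f (suc n) * g 0
    ⊛-suc′ f g zero    = begin
      f 0 * g 1 + (f 1 * g 0 + 0#)  ≈⟨ +-congˡ (+-identityʳ _) ⟩
      f 0 * g 1 + f 1 * g 0         ≈⟨ +-congʳ (+-identityʳ _) ⟨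
      (f 0 * g 1 + 0#) + f 1 * g 0  ∎
    ⊛-suc′ f g (suc n) = begin
      f 0 * g (2 ℕ.+ n) + (tail f ⊛ g) (suc n)
        ≈⟨ +-congˡ (⊛-suc′ (tail f) g n) ⟩
      f 0 * g (2 ℕ.+ n) + ((tail f ⊛ tail g) n + f (2 ℕ.+ n) * g 0)
        ≈⟨ +-assoc _ _ _ ⟨
      (f ⊛ tail g) (suc n) + f (2 ℕ.+ n) * g 0
        ∎

    ⊛-comm : ∀ f g → f ⊛ g ≗ g ⊛ f
    ⊛-comm f g zero    = +-congʳ (*-comm (f 0) (g 0))
    ⊛-comm f g (suc n) = begin
      f 0 * g (suc n) + (tail f ⊛ g) n  ≈⟨ +-cong (*-comm _ _) (⊛-comm (tail f) g n) ⟩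
      g (suc n) * f 0 + (g ⊛ tail f) n  ≈⟨ +-comm _ _ ⟩
      (g ⊛ tail f) n + g (suc n) * f 0  ≈⟨ ⊛-suc′ g f n ⟨
      (g ⊛ f) (suc n)                   ∎

    ⊛-distribʳ : ∀ f g h → (g ⊕ h) ⊛ f ≗ g ⊛ f ⊕ h ⊛ f
    ⊛-distribʳ f g h n = begin
      ((g ⊕ h) ⊛ f) n        ≈⟨ ⊛-comm (g ⊕ h) f n ⟩
      (f ⊛ (g ⊕ h)) n        ≈⟨ ⊛-distribˡ f g h n ⟩
      (f ⊛ g) n + (f ⊛ h) n  ≈⟨ +-cong (⊛-comm f g n) (⊛-comm f h n) ⟩
      (g ⊛ f) n + (h ⊛ f) n  ∎

    ·-⊛ : ∀ r f g → (r · f) ⊛ g ≗ r · (f ⊛ g)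
    ·-⊛ r f g n = trans
      (sum-cong-≋ {suc n} (λ i → *-assoc r (f (toℕ i)) (g (n ∸ toℕ i))))
      (sym (*-distribˡ-sum {suc n} r (λ i → f (toℕ i) * g (n ∸ toℕ i))))

    ⊛-assoc : ∀ f g h → (f ⊛ g) ⊛ h ≗ f ⊛ (g ⊛ h)
    ⊛-assoc f g h zero    = +-congʳ (begin
      (f 0 * g 0 + 0#) * h 0  ≈⟨ *-congʳ (+-identityʳ _) ⟩
      (f 0 * g 0) * h 0       ≈⟨ *-assoc _ _ _ ⟩
      f 0 * (g 0 * h 0)       ≈⟨ *-congˡ (+-identityʳ _) ⟨
      f 0 * (g 0 * h 0 + 0#)  ∎)
    ⊛-assoc f g h (suc n) = begin
      (f 0 * g 0 + 0#) * h (suc n) + ((f 0 · tail g ⊕ tail f ⊛ g) ⊛ h) n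
        ≈⟨ +-cong (*-congʳ (+-identityʳ _)) (⊛-distribʳ h (f 0 · tail g) (tail f ⊛ g) n) ⟩
      (f 0 * g 0) * h (suc n) + (((f 0 · tail g) ⊛ h) n + ((tail f ⊛ g) ⊛ h) n)
        ≈⟨ +-cong (*-assoc _ _ _) (+-cong (·-⊛ (f 0) (tail g) h n) (⊛-assoc (tail f) g h n)) ⟩
      f 0 * (g 0 * h (suc n)) + (f 0 * (tail g ⊛ h) n + (tail f ⊛ (g ⊛ h)) n)
        ≈⟨ +-assoc _ _ _ ⟨
      (f 0 * (g 0 * h (suc n)) + f 0 * (tail g ⊛ h) n) + (tail f ⊛ (g ⊛ h)) n
        ≈⟨ +-congʳ (distribˡ _ _ _) ⟨
      f 0 * (g ⊛ h) (suc n) + (tail f ⊛ (g ⊛ h)) n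
        ∎

    0-⊛ : ∀ f → constant 0# ⊛ f ≗ constant 0#
    0-⊛ f zero    = trans (+-identityʳ _) (zeroˡ _)
    0-⊛ f (suc n) = begin
      0# * f (suc n) + (tail (constant 0#) ⊛ f) n
        ≈⟨ +-cong (zeroˡ _) (⊛-cong {g = f} tail-0 (λ _ → refl) n) ⟩
      0# + (constant 0# ⊛ f) n  ≈⟨ +-identityˡ _ ⟩
      (constant 0# ⊛ f) n       ≈⟨ 0-⊛ f n ⟩
      constant 0# n             ≈⟨ tail-0 n ⟨
      0#                     ∎
      where
      tail-0 : tail (constant 0#) ≗ constant 0#
      tail-0 zero    = refl
      tail-0 (suc n) = refl

    ⊛-identityˡ : ∀ f → constant 1# ⊛ f ≗ f
    ⊛-identityˡ f zero    = trans (+-identityʳ _) (*-identityˡ _)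
    ⊛-identityˡ f (suc n) = begin
      1# * f (suc n) + (tail (constant 1#) ⊛ f) n
        ≈⟨ +-cong (*-identityˡ _) (⊛-cong {g = f} tail-1 (λ _ → refl) n) ⟩
      f (suc n) + (constant 0# ⊛ f) n  ≈⟨ +-congˡ (0-⊛ f n) ⟩
      f (suc n) + constant 0# n        ≈⟨ +-congˡ (tail-1 n) ⟨
      f (suc n) + 0#                ≈⟨ +-identityʳ _ ⟩
      f (suc n)                     ∎
      where
      tail-1 : tail (constant 1#) ≗ constant 0#
      tail-1 zero    = refl
      tail-1 (suc n) = refl

    ⊕-identityˡ : ∀ f → constant 0# ⊕ f ≗ f
    ⊕-identityˡ f zero    = +-identityˡ _
    ⊕-identityˡ f (suc n) = +-identityˡ _

    ⊕-inverseˡ : ∀ f → (λ n → - f n) ⊕ f ≗ constant 0#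
    ⊕-inverseˡ f zero    = -‿inverseˡ _
    ⊕-inverseˡ f (suc n) = -‿inverseˡ _

  commutativeRing : CommutativeRing c ℓ
  commutativeRing = record
    { Carrier = Series
    ; _≈_     = _≋_
    ; _+_     = _⊞_
    ; _*_     = _⊠_
    ; -_      = ⊟_
    ; 0#      = const 0#
    ; 1#      = const 1#
    ; isCommutativeRing = record
      { isRing = record
        { +-isAbelianGroup = record
          { isGroup = record
            { isMonoid = record
              { isSemigroup = record
                { isMagma = record
                  { isEquivalence = record
                    { refl  = mk≋ λ _ → refl
                    ; sym   = λ f≋g → mk≋ λ n → sym (coeff-≈ f≋g n)
                    ; trans = λ f≋g g≋h →
                        mk≋ λ n → trans (coeff-≈ f≋g n) (coeff-≈ g≋h n)
                    }
                  ; ∙-cong = λ f≋f′ g≋g′ →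
                      mk≋ λ n → +-cong (coeff-≈ f≋f′ n) (coeff-≈ g≋g′ n)
                  }
                ; assoc = λ f g h → mk≋ λ n → +-assoc _ _ _
                }
              ; identity = (λ f → mk≋ (⊕-identityˡ (coeff f)))
                         , (λ f → mk≋ λ n →
                              trans (+-comm _ _) (⊕-identityˡ (coeff f) n))
              }
            ; inverse = (λ f → mk≋ (⊕-inverseˡ (coeff f)))
                      , (λ f → mk≋ λ n →
                           trans (+-comm _ _) (⊕-inverseˡ (coeff f) n))
            ; ⁻¹-cong = λ f≋g → mk≋ λ n → -‿cong (coeff-≈ f≋g n)
            }
          ; comm = λ f g → mk≋ λ n → +-comm _ _
          }
        ; *-cong     = λ f≋f′ g≋g′ → mk≋ (⊛-cong (coeff-≈ f≋f′) (coeff-≈ g≋g′))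
        ; *-assoc    = λ f g h → mk≋ (⊛-assoc (coeff f) (coeff g) (coeff h))
        ; *-identity = (λ f → mk≋ (⊛-identityˡ (coeff f)))
                     , (λ f → mk≋ λ n →
                          trans (⊛-comm (coeff f) (constant 1#) n)
                                (⊛-identityˡ (coeff f) n))
        ; distrib    = (λ f g h → mk≋ (⊛-distribˡ (coeff f) (coeff g) (coeff h)))
                     , (λ f g h → mk≋ (⊛-distribʳ (coeff f) (coeff g) (coeff h)))
        }
      ; *-comm = λ f g → mk≋ (⊛-comm (coeff f) (coeff g))
      }
    }

infixl 10 _⟦X⟧

_⟦X⟧ : CommutativeRing c ℓ → CommutativeRing c ℓ
R ⟦X⟧ = PowerSeries.commutativeRing R

words : List A → ∀ k → List (Vec A k)
words as zero    = [] ∷ []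
words as (suc k) = cartesianProductWith _∷_ as (words as k)

anyVec? : {P : Pred (Vec (Fin n) k) ℓ} → Decidable P → Dec (∃ P)
anyVec? {k = zero}  P? = map′ ([] ,_) (λ { ([] , p) → p }) (P? [])
anyVec? {k = suc k} P? =
  map′ (λ { (x , v , p) → x ∷ v , p }) (λ { (x ∷ v , p) → x , v , p })
       (Fin.any? λ x → anyVec? λ v → P? (x ∷ v))

-- A permutation of [n] is a word of length n over Fin n with distinct letters,
-- so values and positions start at 0.  Patterns are encoded in the same way.

permutations : ∀ n → List (Vec (Fin n) n)
permutations n = filter unique? (words (allFin n) n)
  where
  unique? : (π : Vec (Fin n) n) → Dec (Unique π)
  unique? = allPairs? λ i j → ¬? (i Fin.≟ j)

τ₂₁₃ τ₂₃₁ : Vec (Fin 3) 3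
τ₂₁₃ = 1F ∷ 0F ∷ 2F ∷ []
τ₂₃₁ = 1F ∷ 2F ∷ 0F ∷ []

Occurrence : Vec (Fin n) n → Vec (Fin k) k → Vec (Fin n) k → Set
Occurrence π τ i =
  (∀ a b → a Fin.< b → lookup i a Fin.< lookup i b) ×
  (∀ a b → (lookup π (lookup i a) Fin.< lookup π (lookup i b))
             ⇔ (lookup τ a Fin.< lookup τ b))

Avoids : Vec (Fin n) n → Vec (Fin k) k → Set
Avoids π τ = ¬ ∃ (Occurrence π τ)

_⇔-dec_ : Dec A → Dec B → Dec (A ⇔ B)
a? ⇔-dec b? = map′ (uncurry mk⇔) < Equivalence.to , Equivalence.from >
                   ((a? →-dec b?) ×-dec (b? →-dec a?))

avoids? : (π : Vec (Fin n) n) (τ : Vec (Fin k) k) → Dec (Avoids π τ)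
avoids? π τ = ¬? (anyVec? λ i →
  (Fin.all? λ a → Fin.all? λ b → (a Fin.<? b) →-dec (lookup i a Fin.<? lookup i b))
  ×-dec
  (Fin.all? λ a → Fin.all? λ b →
    (lookup π (lookup i a) Fin.<? lookup π (lookup i b))
      ⇔-dec (lookup τ a Fin.<? lookup τ b)))

S : ∀ n → Vec (Fin k) k → Vec (Fin m) m → List (Vec (Fin n) n)
S n τ ρ = filter (λ π → avoids? π τ ×-dec avoids? π ρ) (permutations n)

ascents : Vec (Fin n) k → Subset (pred k)
ascents {k = zero}  π = []
ascents {k = suc k} π =
  tabulate λ i → does (lookup π (inject₁ i) Fin.<? lookup π (suc i))

descents : Vec (Fin n) k → Subset (pred k)
descents {k = zero}  π = []
descents {k = suc k} π =
  tabulate λ i → does (lookup π (suc i) Fin.<? lookup π (inject₁ i))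

NonOverlapping : Subset m → Set
NonOverlapping I = ∀ i j → i ∈ I → j ∈ I → i ≢ j → 2 ℕ.≤ ∣ toℕ i - toℕ j ∣

nonOverlapping? : (I : Subset m) → Dec (NonOverlapping I)
nonOverlapping? I = Fin.all? λ i → Fin.all? λ j →
  (i ∈? I) →-dec ((j ∈? I) →-dec (¬? (i Fin.≟ j) →-dec (2 ℕ.≤? ∣ toℕ i - toℕ j ∣)))

-- The default value 0 of max is harmless: the empty set always qualifies.
maxNonOverlapping : Subset m → ℕ
maxNonOverlapping {m} J =
  max 0 (List.map ∣_∣ (filter (λ I → (I ⊆? J) ×-dec nonOverlapping? I)
                              (words (true ∷ false ∷ []) m)))

asc des MNA MND : Vec (Fin n) n → ℕ
asc π = ∣ ascents π ∣
des π = ∣ descents π ∣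
MNA π = maxNonOverlapping (ascents π)
MND π = maxNonOverlapping (descents π)

ℤ⟦p⟧ ℤ⟦p,q⟧ ℤ⟦p,q,y⟧ ℤ⟦p,q,y,z⟧ ℤ⟦p,q,y,z,x⟧ : CommutativeRing 0ℓ 0ℓ
ℤ⟦p⟧         = +-*-commutativeRing ⟦X⟧
ℤ⟦p,q⟧       = ℤ⟦p⟧ ⟦X⟧
ℤ⟦p,q,y⟧     = ℤ⟦p,q⟧ ⟦X⟧
ℤ⟦p,q,y,z⟧   = ℤ⟦p,q,y⟧ ⟦X⟧
ℤ⟦p,q,y,z,x⟧ = ℤ⟦p,q,y,z⟧ ⟦X⟧

module Coefficients where

  open CommutativeRing ℤ⟦p,q,y,z⟧ using (Carrier; _+_; _*_; 0#; semiring)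
  open Exp semiring using (_^_)

  open PowerSeries +-*-commutativeRing using () renaming (X to X₁)
  open PowerSeries ℤ⟦p⟧ using () renaming (X to X₂; const to const₂)
  open PowerSeries ℤ⟦p,q⟧ using () renaming (X to X₃; const to const₃)
  open PowerSeries ℤ⟦p,q,y⟧ using () renaming (X to X₄; const to const₄)

  p q y z : Carrier
  p = const₄ (const₃ (const₂ X₁))
  q = const₄ (const₃ X₂)
  y = const₄ X₃
  z = X₄

  weight : Vec (Fin n) n → Carrier
  weight π = p ^ asc π * q ^ des π * y ^ MNA π * z ^ MND π

  ∑-list : List A → (A → Carrier) → Carrier
  ∑-list as w = foldr (λ a s → w a + s) 0# as

open CommutativeRing ℤ⟦p,q,y,z,x⟧ public
  using (Carrier; _≈_; _+_; _*_; _-_; 1#)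
open Exp (CommutativeRing.semiring ℤ⟦p,q,y,z,x⟧) public
  using (_^_)
open PowerSeries ℤ⟦p,q,y,z⟧ using (X; const; coeff)

x p q y z : Carrier
x = X
p = const Coefficients.p
q = const Coefficients.q
y = const Coefficients.y
z = const Coefficients.z

G : Vec (Fin k) k → Vec (Fin m) m → Carrier
coeff (G τ ρ) n = Coefficients.∑-list (S n τ ρ) Coefficients.weight

infix 4 _≈_/_

-- f ≈ g / h asserts in particular that h is a unit; its inverse is then unique.
_≈_/_ : Carrier → Carrier → Carrier → Set
f ≈ g / h = ∃ λ h⁻¹ → (h * h⁻¹ ≈ 1#) × (f ≈ g * h⁻¹)

{-# OPTIONS --safe #-}

-- A permutation avoids 213 and 231 exactly when no entry has both a smaller and
-- a larger entry to its right, i.e. when every entry is the minimum or the maximum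
-- of the suffix it starts.  Recording which of the two happens identifies
-- S_{n+1}(213,231) with the Boolean words of length n, and the word is the ascent
-- set.  MNA and MND are computed greedily from the left, so splitting words by their
-- first letters gives, for the series F of all words and its parts B and C of words
-- starting with an ascent or a descent,
--   F = 1 + B + C,  B = pxy (1 + C + px F),  C = qxz (1 + B + qx F),
-- and G = 1 + x F.  With P = (1 + pxy)(1 + qxz), elimination gives D F = P for the
-- denominator D, and the numerator is D + x P.  In particular F P⁻¹ inverts D.

module Submission where

open import Algebra.Bundles using (CommutativeRing)
import Algebra.Properties.AbelianGroup as AbelianGroupProperties
import Algebra.Properties.Ring as RingProperties
import Algebra.Properties.Semiring.Exp as Exp
import Algebra.Properties.Semiring.Sum as Sum
import Algebra.Solver.Ring.NaturalCoefficients.Default as Solver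
open import Data.Bool.Base using (Bool; true; false; not; if_then_else_)
open import Data.Fin.Base using (Fin; zero; suc; toℕ; fromℕ; inject₁; punchIn; punchOut; _<_)
open import Data.Fin.Patterns using (0F; 1F; 2F)
import Data.Fin.Properties as Fin
open import Data.Fin.Subset using (Subset; _⊆_; ∁; ∣_∣)
open import Data.Fin.Subset.Properties using (_⊆?_; drop-∷-⊆; out⊆; in⊆in; p⊆q⇒∣p∣≤∣q∣)
open import Data.List.Base as List using (List; []; _∷_; _++_; foldr)
open import Data.List.Extrema.Nat using (max≤v⁺; v≤max⁺)
import Data.List.Membership.Propositional as List
open import Data.List.Membership.Propositional.Properties
  using (∈-map⁺; ∈-map⁻; ∈-filter⁺; ∈-filter⁻; ∈-cartesianProductWith⁺; ∈-allFin)
open import Data.List.Membership.Propositional.Properties.WithK using (unique∧set⇒bag)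
open import Data.List.Relation.Binary.BagAndSetEquality using (∼bag⇒↭)
open import Data.List.Relation.Binary.Permutation.Propositional as Perm using (_↭_)
import Data.List.Relation.Unary.All as ListAll
import Data.List.Relation.Unary.All.Properties as ListAll
import Data.List.Relation.Unary.AllPairs as ListPairs
open import Data.List.Relation.Unary.Any using (here; there)
import Data.List.Relation.Unary.Unique.Propositional as List
import Data.List.Relation.Unary.Unique.Propositional.Properties as List
open import Data.Nat.Base as ℕ using (ℕ; zero; suc; z≤n; s≤s)
import Data.Nat.Properties as ℕ
open import Data.Product.Base using (∃; _×_; _,_; proj₂)
open import Data.Sum.Base using (inj₂)
open import Data.Vec.Base using (Vec; []; _∷_; lookup; map; here; there)
open import Data.Vec.Properties using (∷-injective; lookup-map; tabulate-cong)
open import Data.Vec.Relation.Unary.All as All using (All; []; _∷_)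
import Data.Vec.Relation.Unary.All.Properties as All
open import Data.Vec.Relation.Unary.AllPairs using ([]; _∷_; allPairs?)
open import Data.Vec.Relation.Unary.Unique.Propositional using (Unique)
import Data.Vec.Relation.Unary.Unique.Propositional.Properties as Unique
open import Function.Base using (_∘_)
open import Function.Bundles using (_⇔_; mk⇔; Equivalence)
open import Level using (Level)
open import Relation.Binary.Definitions using (tri<; tri≈; tri>)
open import Relation.Nullary using (¬_; Dec; yes; no; does; contradiction)
open import Relation.Nullary.Decidable using (does-⇔; dec-true; dec-false; _×-dec_; ¬?)

open import Defs using (words; module PowerSeries; _⟦X⟧)

private
  variable
    a c ℓ : Level
    A : Set a
    k m n : ℕ

bools : List Bool
bools = true ∷ false ∷ []

-- Eliminating the two auxiliary series

module _ (R : CommutativeRing c ℓ) where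

  open CommutativeRing R
  open Exp semiring using (_^_)
  open AbelianGroupProperties +-abelianGroup using () renaming (⁻¹-∙-comm to -‿+-comm)
  open RingProperties ring using (-‿distribˡ-*)
  open Solver commutativeSemiring using (solve; con; _:=_; _:+_; _:*_; _:^_)
  open import Relation.Binary.Reasoning.Setoid setoid

  module _ (x p q y z : Carrier) where

    numerator denominator : Carrier
    numerator =
      1# + x + p * x ^ 2 * y - p ^ 2 * x ^ 2 * y + q * x ^ 2 * z - q ^ 2 * x ^ 2 * z
           - p * q * x ^ 2 * y * z + p * q * x ^ 3 * y * z
           - p ^ 2 * q * x ^ 3 * y * z - p * q ^ 2 * x ^ 3 * y * z
    denominator =
      1# - p ^ 2 * x ^ 2 * y - q ^ 2 * x ^ 2 * z - p * q * x ^ 2 * y * z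
         - p ^ 2 * q * x ^ 3 * y * z - p * q ^ 2 * x ^ 3 * y * z

    -- It is `1# - denominator`, kept free of subtraction so that the semiring solver can treat it.
    defect : Carrier
    defect = p ^ 2 * x ^ 2 * y + q ^ 2 * x ^ 2 * z + p * q * x ^ 2 * y * z
         + p ^ 2 * q * x ^ 3 * y * z + p * q ^ 2 * x ^ 3 * y * z

    P : Carrier
    P = (1# + x * (p * y)) * (1# + x * (q * z))

    -- The solver has no subtraction, so the negated monomials are passed to it as atoms.
    numerator≈ : numerator ≈ denominator + x * P
    numerator≈ =
      solve 10 (λ x p q y z n₁ n₂ n₃ n₄ n₅ →
          con 1 :+ x :+ p :* x :^ 2 :* y :+ n₁ :+ q :* x :^ 2 :* z :+ n₂
            :+ n₃ :+ p :* q :* x :^ 3 :* y :* z :+ n₄ :+ n₅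
        := con 1 :+ n₁ :+ n₂ :+ n₃ :+ n₄ :+ n₅
             :+ x :* ((con 1 :+ x :* (p :* y)) :* (con 1 :+ x :* (q :* z))))
        refl x p q y z
        (- (p ^ 2 * x ^ 2 * y)) (- (q ^ 2 * x ^ 2 * z)) (- (p * q * x ^ 2 * y * z))
        (- (p ^ 2 * q * x ^ 3 * y * z)) (- (p * q ^ 2 * x ^ 3 * y * z))

    minus-minus : ∀ u v w → u - v - w ≈ u - (v + w)
    minus-minus u v w = begin
      u - v - w        ≈⟨ +-assoc u (- v) (- w) ⟩
      u + (- v - w)    ≈⟨ +-congˡ (-‿+-comm v w) ⟩
      u - (v + w)      ∎

    denominator≈ : denominator ≈ 1# - defect
    denominator≈ = begin
      denominator ≈⟨ +-congʳ (+-congʳ (+-congʳ (minus-minus _ _ _))) ⟩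
      _           ≈⟨ +-congʳ (+-congʳ (minus-minus _ _ _)) ⟩
      _           ≈⟨ +-congʳ (minus-minus _ _ _) ⟩
      _           ≈⟨ minus-minus _ _ _ ⟩
      1# - defect ∎

    module _ {F B C : Carrier}
      (F≈ : F ≈ 1# + B + C)
      (B≈ : B ≈ x * (p * (y * (1# + C + x * (p * F)))))
      (C≈ : C ≈ x * (q * (z * (1# + B + x * (q * F)))))
      where

      -- The equations for `B` and `C` are inserted twice. What then remains of `B` and `C` occurs
      -- only in the combination `1# + B + C`, which is `F` again, so no division is required.
      F≈P+defect*F : F ≈ P + defect * F
      F≈P+defect*F = begin
        F
          ≈⟨ F≈ ⟩
        1# + B + C
          ≈⟨ +-cong (+-congˡ B≈) C≈ ⟩
        1# + x * (p * (y * (1# + C + x * (p * F)))) + x * (q * (z * (1# + B + x * (q * F))))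
          ≈⟨ +-cong
               (+-congˡ (*-congˡ (*-congˡ (*-congˡ (+-congʳ (+-congˡ C≈))))))
               (*-congˡ (*-congˡ (*-congˡ (+-congʳ (+-congˡ B≈))))) ⟩
        1# + x * (p * (y * (1# + x * (q * (z * (1# + B + x * (q * F)))) + x * (p * F))))
           + x * (q * (z * (1# + x * (p * (y * (1# + C + x * (p * F)))) + x * (q * F))))
          ≈⟨ solve 8 (λ x p q y z F B C →
               con 1
                 :+ x :* (p :* (y :* (con 1 :+ x :* (q :* (z :* (con 1 :+ B :+ x :* (q :* F))))
                                            :+ x :* (p :* F))))
                 :+ x :* (q :* (z :* (con 1 :+ x :* (p :* (y :* (con 1 :+ C :+ x :* (p :* F))))
                                            :+ x :* (q :* F))))
               := (con 1 :+ x :* (p :* y)) :* (con 1 :+ x :* (q :* z))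
                  :+ (p :* q :* x :^ 2 :* y :* z :* (con 1 :+ B :+ C)
                      :+ (p :^ 2 :* x :^ 2 :* y :+ q :^ 2 :* x :^ 2 :* z
                       :+ p :^ 2 :* q :* x :^ 3 :* y :* z :+ p :* q :^ 2 :* x :^ 3 :* y :* z) :* F))
               refl x p q y z F B C ⟩
        P + (p * q * x ^ 2 * y * z * (1# + B + C)
             + (p ^ 2 * x ^ 2 * y + q ^ 2 * x ^ 2 * z
                + p ^ 2 * q * x ^ 3 * y * z + p * q ^ 2 * x ^ 3 * y * z) * F)
          -- The remaining `1# + B + C` folds back into `F`; its coefficient is the third monomial
          -- of `defect`.
          ≈⟨ +-congˡ (+-congʳ (*-congˡ F≈)) ⟨
        P + (p * q * x ^ 2 * y * z * F
             + (p ^ 2 * x ^ 2 * y + q ^ 2 * x ^ 2 * z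
                + p ^ 2 * q * x ^ 3 * y * z + p * q ^ 2 * x ^ 3 * y * z) * F)
          ≈⟨ +-congˡ (solve 6 (λ t₁ t₂ t₃ t₄ t₅ F →
               t₃ :* F :+ (t₁ :+ t₂ :+ t₄ :+ t₅) :* F := (t₁ :+ t₂ :+ t₃ :+ t₄ :+ t₅) :* F)
               refl (p ^ 2 * x ^ 2 * y) (q ^ 2 * x ^ 2 * z) (p * q * x ^ 2 * y * z)
               (p ^ 2 * q * x ^ 3 * y * z) (p * q ^ 2 * x ^ 3 * y * z) F) ⟩
        P + defect * F
          ∎

      denominator*F : denominator * F ≈ P
      denominator*F = begin
        denominator * F                 ≈⟨ *-congʳ denominator≈ ⟩
        (1# - defect) * F               ≈⟨ distribʳ F 1# (- defect) ⟩
        1# * F + - defect * F           ≈⟨ +-cong (*-identityˡ F) (sym (-‿distribˡ-* defect F)) ⟩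
        F - defect * F                  ≈⟨ +-congʳ F≈P+defect*F ⟩
        P + defect * F - defect * F     ≈⟨ +-assoc _ _ _ ⟩
        P + (defect * F - defect * F)   ≈⟨ +-congˡ (-‿inverseʳ _) ⟩
        P + 0#                          ≈⟨ +-identityʳ P ⟩
        P                               ∎

      module _ {G U V : Carrier}
        (G≈ : G ≈ 1# + x * F)
        (U≈ : U + x * (p * (y * U)) ≈ 1#)
        (V≈ : V + x * (q * (z * V)) ≈ 1#)
        where

        P*UV : P * (U * V) ≈ 1#
        P*UV = begin
          P * (U * V)
            ≈⟨ solve 7 (λ x p q y z U V →
                 ((con 1 :+ x :* (p :* y)) :* (con 1 :+ x :* (q :* z))) :* (U :* V)
                 := (U :+ x :* (p :* (y :* U))) :* (V :+ x :* (q :* (z :* V))))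
                 refl x p q y z U V ⟩
          (U + x * (p * (y * U))) * (V + x * (q * (z * V)))
            ≈⟨ *-cong U≈ V≈ ⟩
          1# * 1#
            ≈⟨ *-identityˡ 1# ⟩
          1# ∎

        quotient : ∃ λ h⁻¹ → (denominator * h⁻¹ ≈ 1#) × (G ≈ numerator * h⁻¹)
        -- With `W = F * (U * V)`, `denominator * W` is `1#` and `x * P * W` is `x * F`; adding
        -- these turns `1# + x * F` into `numerator * W`.
        quotient = F * (U * V) , inverse , (begin
          G                                            ≈⟨ G≈ ⟩
          1# + x * F                                   ≈⟨ +-cong inverse x*F ⟨
          denominator * (F * (U * V)) + x * P * (F * (U * V))
                                                       ≈⟨ distribʳ _ _ _ ⟨
          (denominator + x * P) * (F * (U * V))        ≈⟨ *-congʳ numerator≈ ⟨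
          numerator * (F * (U * V))                    ∎)
          where
          inverse : denominator * (F * (U * V)) ≈ 1#
          inverse = begin
            denominator * (F * (U * V))  ≈⟨ *-assoc _ _ _ ⟨
            denominator * F * (U * V)    ≈⟨ *-congʳ denominator*F ⟩
            P * (U * V)                  ≈⟨ P*UV ⟩
            1#                           ∎
          x*F : x * P * (F * (U * V)) ≈ x * F
          x*F = begin
            x * P * (F * (U * V))
              ≈⟨ solve 4 (λ x P F W → x :* P :* (F :* W) := x :* F :* (P :* W))
                   refl x P F (U * V) ⟩
            x * F * (P * (U * V))  ≈⟨ *-congˡ P*UV ⟩
            x * F * 1#             ≈⟨ *-identityʳ _ ⟩
            x * F                  ∎

-- Summing over words

-- After a chosen position the next one is skipped, whatever `b` is. This recursion from the left is
-- what allows weights to be computed from the first two letters of a word.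
greedy : Subset n → ℕ
greedy []             = 0
greedy (false ∷ J)    = greedy J
greedy (true ∷ [])    = 1
greedy (true ∷ b ∷ J) = suc (greedy J)

module _ (R : CommutativeRing c ℓ) where

  open CommutativeRing R
  open PowerSeries R
  open Exp semiring using (_^_)
  open Solver commutativeSemiring using (solve; con; _:=_; _:+_; _:*_)
  open Sum semiring using (sum; sum-cong-≋; sum-replicate-zero)
  open import Relation.Binary.Reasoning.Setoid setoid
  private module R⟦X⟧ = CommutativeRing (R ⟦X⟧)

  X⊠-suc : ∀ f n → coeff (X ⊠ f) (suc n) ≈ coeff f n
  X⊠-suc f n = begin
    0# * coeff f (suc n) + coeff (const 1# ⊠ f) n
      ≈⟨ +-cong (zeroˡ _) (coeff-≈ (R⟦X⟧.*-identityˡ f) n) ⟩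
    0# + coeff f n  ≈⟨ +-identityˡ _ ⟩
    coeff f n       ∎

  X⊠-zero : ∀ f → coeff (X ⊠ f) 0 ≈ 0#
  X⊠-zero f = trans (+-identityʳ _) (zeroˡ _)

  const⊠ : ∀ r f n → coeff (const r ⊠ f) n ≈ r * coeff f n
  const⊠ r f zero    = +-identityʳ _
  const⊠ r f (suc n) = begin
    r * coeff f (suc n) + sum {suc n} (λ i → 0# * coeff f (n ℕ.∸ toℕ i))
      ≈⟨ +-congˡ (sum-cong-≋ {suc n} (λ i → zeroˡ (coeff f (n ℕ.∸ toℕ i)))) ⟩
    r * coeff f (suc n) + sum {suc n} (λ i → 0#)
      ≈⟨ +-congˡ (sum-replicate-zero (suc n)) ⟩
    r * coeff f (suc n) + 0#
      ≈⟨ +-identityʳ _ ⟩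
    r * coeff f (suc n) ∎

  X⊠const²-suc : ∀ r s f n →
    coeff (X ⊠ (const r ⊠ (const s ⊠ f))) (suc n) ≈ r * (s * coeff f n)
  X⊠const²-suc r s f n = begin
    coeff (X ⊠ (const r ⊠ (const s ⊠ f))) (suc n)  ≈⟨ X⊠-suc (const r ⊠ (const s ⊠ f)) n ⟩
    coeff (const r ⊠ (const s ⊠ f)) n              ≈⟨ const⊠ r (const s ⊠ f) n ⟩
    r * coeff (const s ⊠ f) n                      ≈⟨ *-congˡ (const⊠ s f n) ⟩
    r * (s * coeff f n)                            ∎

  -- The expansion of `1 / (1 + r s X)`. Two such series invert the two factors of `P`.
  geometric : Carrier → Carrier → Series
  coeff (geometric r s) zero    = 1#
  coeff (geometric r s) (suc n) = - (r * (s * coeff (geometric r s) n))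

  geometric≈ : ∀ r s → let U = geometric r s in
               U ⊞ X ⊠ (const r ⊠ (const s ⊠ U)) ≋ const 1#
  geometric≈ r s = mk≋ λ where
      zero    → trans (+-congˡ (X⊠-zero (const r ⊠ (const s ⊠ U)))) (+-identityʳ 1#)
      (suc n) → trans (+-congˡ (X⊠const²-suc r s U n)) (-‿inverseˡ _)
    where
    U : Series
    U = geometric r s

  -- Over `ℤ⟦p,q,y,z⟧` this unfolds to the same fold as `Coefficients.∑-list`, so the lemmas below
  -- apply directly to the coefficients of `G`.
  ∑-list : List A → (A → Carrier) → Carrier
  ∑-list as w = foldr (λ a s → w a + s) 0# as

  ∑-cong : ∀ (as : List A) {v w : A → Carrier} → (∀ a → v a ≈ w a) → ∑-list as v ≈ ∑-list as w
  ∑-cong []       v≈w = refl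
  ∑-cong (a ∷ as) v≈w = +-cong (v≈w a) (∑-cong as v≈w)

  ∑-++ : ∀ (as bs : List A) {w} → ∑-list (as ++ bs) w ≈ ∑-list as w + ∑-list bs w
  ∑-++ []       bs = sym (+-identityˡ _)
  ∑-++ (a ∷ as) bs = trans (+-congˡ (∑-++ as bs)) (sym (+-assoc _ _ _))

  ∑-map : ∀ {b} {B : Set b} (f : A → B) (as : List A) {w} →
          ∑-list (List.map f as) w ≈ ∑-list as (w ∘ f)
  ∑-map f []       = refl
  ∑-map f (a ∷ as) = +-congˡ (∑-map f as)

  ∑-* : ∀ r (as : List A) {w} → ∑-list as (λ a → r * w a) ≈ r * ∑-list as w
  ∑-* r []       = sym (zeroʳ r)
  ∑-* r (a ∷ as) = trans (+-congˡ (∑-* r as)) (sym (distribˡ r _ _))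

  ∑-↭ : ∀ {as bs : List A} {w} → as ↭ bs → ∑-list as w ≈ ∑-list bs w
  ∑-↭ Perm.refl           = refl
  ∑-↭ (Perm.prep a as↭bs) = +-congˡ (∑-↭ as↭bs)
  ∑-↭ {w = w} (Perm.swap {xs} {ys} a b as↭bs) = begin
    w a + (w b + ∑-list xs w)  ≈⟨ +-assoc _ _ _ ⟨
    w a + w b + ∑-list xs w    ≈⟨ +-cong (+-comm _ _) (∑-↭ as↭bs) ⟩
    w b + w a + ∑-list ys w    ≈⟨ +-assoc _ _ _ ⟩
    w b + (w a + ∑-list ys w)  ∎
  ∑-↭ (Perm.trans ↭₁ ↭₂) = trans (∑-↭ ↭₁) (∑-↭ ↭₂)

  -- The letter `b` fixes which half comes first, so that a split by the second letter can be
  -- ordered relative to the first letter.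
  ∑-words-suc : ∀ n {w : Vec Bool (suc n) → Carrier} b →
    ∑-list (words bools (suc n)) w ≈
    ∑-list (words bools n) (w ∘ (b ∷_)) + ∑-list (words bools n) (w ∘ (not b ∷_))
  ∑-words-suc n {w} b = trans
    (trans (∑-++ (List.map (true ∷_) W) _)
      (+-cong (∑-map (true ∷_) W)
        (trans (∑-++ (List.map (false ∷_) W) []) (trans (+-identityʳ _) (∑-map (false ∷_) W)))))
    (reorder b)
    where
    W : List (Vec Bool n)
    W = words bools n
    reorder : ∀ b → ∑-list W (w ∘ (true ∷_)) + ∑-list W (w ∘ (false ∷_)) ≈
                    ∑-list W (w ∘ (b ∷_)) + ∑-list W (w ∘ (not b ∷_))
    reorder true  = refl
    reorder false = +-comm _ _

  -- Recurrences for the weighted series of words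

  module WordSeries (p q y z : Carrier) where

    wordWeight : Vec Bool n → Carrier
    wordWeight w = p ^ ∣ w ∣ * q ^ ∣ ∁ w ∣ * y ^ greedy w * z ^ greedy (∁ w)

    pq yz : Bool → Carrier
    pq b = if b then p else q
    yz b = if b then y else z

    wordWeight-single : ∀ b → wordWeight (b ∷ []) ≈ pq b * yz b
    wordWeight-single true  = solve 2 (λ p y →
      p :* con 1 :* con 1 :* (y :* con 1) :* con 1 := p :* y) refl p y
    wordWeight-single false = solve 2 (λ q z →
      con 1 :* (q :* con 1) :* con 1 :* (z :* con 1) := q :* z) refl q z

    -- The greedy choice takes the first of two equal letters and skips the second: both count as
    -- ascents (or descents), but only one factor `yz b` arises.
    wordWeight-double : ∀ b (w : Vec Bool n) →
      wordWeight (b ∷ b ∷ w) ≈ pq b * (yz b * (pq b * wordWeight w))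
    wordWeight-double true w = solve 6 (λ p y P Q Y Z →
      p :* (p :* P) :* Q :* (y :* Y) :* Z := p :* (y :* (p :* (P :* Q :* Y :* Z))))
      refl p y _ _ _ _
    wordWeight-double false w = solve 6 (λ q z P Q Y Z →
      P :* (q :* (q :* Q)) :* Y :* (z :* Z) := q :* (z :* (q :* (P :* Q :* Y :* Z))))
      refl q z _ _ _ _

    -- The letter that the greedy choice skips after `b` is `not b`, which would not have been
    -- chosen anyway, so the weight of the rest is unaffected.
    wordWeight-turn : ∀ b (w : Vec Bool n) →
      wordWeight (b ∷ not b ∷ w) ≈ pq b * (yz b * wordWeight (not b ∷ w))
    wordWeight-turn true w = solve 6 (λ p y P Q Y Z →
      p :* P :* Q :* (y :* Y) :* Z := p :* (y :* (P :* Q :* Y :* Z))) refl p y _ _ _ _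
    wordWeight-turn false w = solve 6 (λ q z P Q Y Z →
      P :* (q :* Q) :* Y :* (z :* Z) := q :* (z :* (P :* Q :* Y :* Z))) refl q z _ _ _ _

    allWords : Series
    coeff allWords n = ∑-list (words bools n) wordWeight

    wordsFrom : Bool → Series
    coeff (wordsFrom b) zero    = 0#
    coeff (wordsFrom b) (suc n) = ∑-list (words bools n) (wordWeight ∘ (b ∷_))

    allWords≈ : allWords ≋ const 1# ⊞ wordsFrom true ⊞ wordsFrom false
    allWords≈ = mk≋ λ where
      zero → solve 0 (con 1 :* con 1 :* con 1 :* con 1 :+ con 0 := con 1 :+ con 0 :+ con 0) refl
      (suc n) → trans (∑-words-suc n true) (+-congʳ (sym (+-identityˡ _)))

    -- The summands of `inner` are the three continuations after a first letter `b`: the word ends,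
    -- it turns to `not b`, or `b` is repeated. In the last case the second `b` is skipped by the
    -- greedy choice, and an arbitrary word follows.
    wordsFrom≈ : ∀ b →
      wordsFrom b ≋ X ⊠ (const (pq b) ⊠ (const (yz b) ⊠
        (const 1# ⊞ wordsFrom (not b) ⊞ X ⊠ (const (pq b) ⊠ allWords))))
    wordsFrom≈ b = mk≋ λ where
        zero    → sym (X⊠-zero (const (pq b) ⊠ (const (yz b) ⊠ inner)))
        (suc n) → trans (step n) (sym (X⊠const²-suc (pq b) (yz b) inner n))
      where
      inner : Series
      inner = const 1# ⊞ wordsFrom (not b) ⊞ X ⊠ (const (pq b) ⊠ allWords)

      step : ∀ n → coeff (wordsFrom b) (suc n) ≈ pq b * (yz b * coeff inner n)
      step zero = begin
        wordWeight (b ∷ []) + 0#  ≈⟨ +-identityʳ _ ⟩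
        wordWeight (b ∷ [])       ≈⟨ wordWeight-single b ⟩
        pq b * yz b               ≈⟨ *-congˡ (*-identityʳ _) ⟨
        pq b * (yz b * 1#)
          ≈⟨ *-congˡ (*-congˡ (trans
               (+-cong (+-identityʳ _) (X⊠-zero (const (pq b) ⊠ allWords)))
               (+-identityʳ _))) ⟨
        pq b * (yz b * coeff inner 0)
          ∎
      step (suc n) = begin
        ∑-list (words bools (suc n)) (wordWeight ∘ (b ∷_))
          ≈⟨ ∑-words-suc n (not b) ⟩
        ∑-list W (λ w → wordWeight (b ∷ not b ∷ w))
          + ∑-list W (λ w → wordWeight (b ∷ not (not b) ∷ w))
          ≈⟨ +-cong
               (trans (∑-cong W (wordWeight-turn b))
                 (trans (∑-* _ W) (*-congˡ (∑-* _ W))))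
               (trans (∑-cong W (double b))
                 (trans (∑-* _ W) (*-congˡ (trans (∑-* _ W) (*-congˡ (∑-* _ W)))))) ⟩
        pq b * (yz b * C) + pq b * (yz b * (pq b * F))
          ≈⟨ solve 4 (λ p y C F →
               p :* (y :* C) :+ p :* (y :* (p :* F)) := p :* (y :* (C :+ p :* F)))
               refl (pq b) (yz b) C F ⟩
        pq b * (yz b * (C + pq b * F))
          ≈⟨ *-congˡ (*-congˡ (+-cong (+-identityˡ _)
               (trans (X⊠-suc (const (pq b) ⊠ allWords) n) (const⊠ (pq b) allWords n)))) ⟨
        pq b * (yz b * coeff inner (suc n))
          ∎
        where
        W : List (Vec Bool n)
        W = words bools n
        C F : Carrier
        C = coeff (wordsFrom (not b)) (suc n)
        F = coeff allWords n
        -- `not (not b)` reduces to `b` only once `b` is a constructor, hence the case split.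
        double : ∀ b w → wordWeight (b ∷ not (not b) ∷ w) ≈ pq b * (yz b * (pq b * wordWeight w))
        double true  = wordWeight-double true
        double false = wordWeight-double false

open import Defs
open import Relation.Binary.PropositionalEquality
  using (_≡_; _≢_; refl; sym; trans; cong; cong₂; subst)

-- The greedy choice is a largest non-overlapping subset

∈-bools : ∀ b → b List.∈ bools
∈-bools true  = here refl
∈-bools false = there (here refl)

bools-unique : List.Unique bools
bools-unique = ((λ ()) ListAll.∷ ListAll.[]) ListPairs.∷ ListAll.[] ListPairs.∷ ListPairs.[]

module _ {A : Set} {as : List A} where

  ∈-words : (∀ a → a List.∈ as) → (v : Vec A n) → v List.∈ words as n
  ∈-words ∈as []      = here refl
  ∈-words ∈as (a ∷ v) = ∈-cartesianProductWith⁺ _∷_ (∈as a) (∈-words ∈as v)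

  words-unique : List.Unique as → ∀ n → List.Unique (words as n)
  words-unique as! zero    = ListAll.[] ListPairs.∷ ListPairs.[]
  words-unique as! (suc n) =
    List.cartesianProductWith⁺ _∷_ ∷-injective as! (words-unique as! n)

greedySubset : Subset n → Subset n
greedySubset []             = []
greedySubset (false ∷ J)    = false ∷ greedySubset J
greedySubset (true ∷ [])    = true ∷ []
greedySubset (true ∷ b ∷ J) = true ∷ false ∷ greedySubset J

greedySubset-⊆ : (J : Subset n) → greedySubset J ⊆ J
greedySubset-⊆ []             = λ x → x
greedySubset-⊆ (false ∷ J)    = out⊆ (greedySubset-⊆ J)
greedySubset-⊆ (true ∷ [])    = λ x → x
greedySubset-⊆ (true ∷ b ∷ J) = in⊆in (out⊆ (greedySubset-⊆ J))

∣greedySubset∣ : (J : Subset n) → ∣ greedySubset J ∣ ≡ greedy J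
∣greedySubset∣ []             = refl
∣greedySubset∣ (false ∷ J)    = ∣greedySubset∣ J
∣greedySubset∣ (true ∷ [])    = refl
∣greedySubset∣ (true ∷ b ∷ J) = cong suc (∣greedySubset∣ J)

nonOverlapping-out : {I : Subset n} → NonOverlapping I → NonOverlapping (false ∷ I)
nonOverlapping-out I∥ (suc i) (suc j) (there i∈) (there j∈) i≢j =
  I∥ i j i∈ j∈ (i≢j ∘ cong suc)

nonOverlapping-in-out : {I : Subset n} → NonOverlapping I → NonOverlapping (true ∷ false ∷ I)
nonOverlapping-in-out I∥ zero          zero          _ _ 0≢0 = contradiction refl 0≢0
nonOverlapping-in-out I∥ zero          (suc (suc j)) _ _ _   = s≤s (s≤s z≤n)
nonOverlapping-in-out I∥ (suc (suc i)) zero          _ _ _   = s≤s (s≤s z≤n)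
nonOverlapping-in-out I∥ (suc i)       (suc j)       (there i∈) (there j∈) i≢j =
  nonOverlapping-out I∥ i j i∈ j∈ (i≢j ∘ cong suc)
nonOverlapping-in-out I∥ zero          (suc zero)    _ (there ()) _
nonOverlapping-in-out I∥ (suc zero)    zero          (there ()) _ _

nonOverlapping-tail : ∀ {b} {I : Subset n} → NonOverlapping (b ∷ I) → NonOverlapping I
nonOverlapping-tail I∥ i j i∈ j∈ i≢j =
  I∥ (suc i) (suc j) (there i∈) (there j∈) (i≢j ∘ Fin.suc-injective)

greedySubset-nonOverlapping : (J : Subset n) → NonOverlapping (greedySubset J)
greedySubset-nonOverlapping []             ()
greedySubset-nonOverlapping (false ∷ J)    =
  nonOverlapping-out (greedySubset-nonOverlapping J)
greedySubset-nonOverlapping (true ∷ [])    zero zero _ _ 0≢0 = contradiction refl 0≢0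
greedySubset-nonOverlapping (true ∷ b ∷ J) =
  nonOverlapping-in-out (greedySubset-nonOverlapping J)

-- When `J` starts with `true`, two positions are removed at once: `I` holds at most one of them,
-- while the greedy choice gains exactly one.
∣I∣≤greedy : (I J : Subset n) → I ⊆ J → NonOverlapping I → ∣ I ∣ ℕ.≤ greedy J
∣I∣≤greedy []                 []              _   _  = z≤n
∣I∣≤greedy (false ∷ I)        (false ∷ J)     I⊆J I∥ =
  ∣I∣≤greedy I J (drop-∷-⊆ I⊆J) (nonOverlapping-tail I∥)
∣I∣≤greedy (true ∷ I)         (false ∷ J)     I⊆J _ with () ← I⊆J here
∣I∣≤greedy (b ∷ [])           (true ∷ [])     I⊆J _  = p⊆q⇒∣p∣≤∣q∣ I⊆J
-- Positions 0 and 1 are at distance 1, less than the required 2.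
∣I∣≤greedy (true ∷ true ∷ I)  (true ∷ c ∷ J)  _   I∥
  with s≤s () ← I∥ zero (suc zero) here (there here) (λ ())
∣I∣≤greedy (true ∷ false ∷ I) (true ∷ c ∷ J)  I⊆J I∥ =
  s≤s (∣I∣≤greedy I J (drop-∷-⊆ (drop-∷-⊆ I⊆J)) (nonOverlapping-tail (nonOverlapping-tail I∥)))
∣I∣≤greedy (false ∷ true ∷ I) (true ∷ c ∷ J)  I⊆J I∥ =
  s≤s (∣I∣≤greedy I J (drop-∷-⊆ (drop-∷-⊆ I⊆J)) (nonOverlapping-tail (nonOverlapping-tail I∥)))
∣I∣≤greedy (false ∷ false ∷ I) (true ∷ c ∷ J) I⊆J I∥ =
  ℕ.m≤n⇒m≤1+n
    (∣I∣≤greedy I J (drop-∷-⊆ (drop-∷-⊆ I⊆J)) (nonOverlapping-tail (nonOverlapping-tail I∥)))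

maxNonOverlapping≡greedy : (J : Subset n) → maxNonOverlapping J ≡ greedy J
maxNonOverlapping≡greedy {n} J = ℕ.≤-antisym
  -- `z≤n` bounds the default value 0 of `max`.
  (max≤v⁺ z≤n (ListAll.map⁺ (ListAll.tabulate upper)))
  (v≤max⁺ 0 (List.map ∣_∣ candidates) (inj₂ (List.lose greedy∈ ℕ.≤-refl)))
  where
  valid? : (I : Subset n) → Dec (I ⊆ J × NonOverlapping I)
  valid? I = (I ⊆? J) ×-dec nonOverlapping? I

  candidates : List (Subset n)
  candidates = List.filter valid? (words bools n)

  upper : ∀ {I} → I List.∈ candidates → ∣ I ∣ ℕ.≤ greedy J
  upper {I} I∈ with _ , I⊆J , I∥ ← ∈-filter⁻ valid? {xs = words bools n} I∈ =
    ∣I∣≤greedy I J I⊆J I∥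

  greedy∈ : greedy J List.∈ List.map ∣_∣ candidates
  greedy∈ = subst (List._∈ List.map ∣_∣ candidates) (∣greedySubset∣ J)
    (∈-map⁺ ∣_∣ (∈-filter⁺ valid? (∈-words ∈-bools (greedySubset J))
                  ((λ {x} → greedySubset-⊆ J {x}) , greedySubset-nonOverlapping J)))

-- Permutations avoiding 213 and 231

-- The first entry of a permutation: the minimum if an ascent is to follow, the maximum if a descent
-- is. `punchIn` then spreads the later entries over the remaining values.
pivot : Bool → Fin (suc n)
pivot true  = zero
pivot false = fromℕ _

fromWord : Vec Bool n → Vec (Fin (suc n)) (suc n)
fromWord []      = zero ∷ []
fromWord (b ∷ w) = pivot b ∷ map (punchIn (pivot b)) (fromWord w)

punchIn-< : ∀ (h : Fin (suc n)) {i j} → (punchIn h i < punchIn h j) ⇔ (i < j)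
punchIn-< h {i} {j} = mk⇔
  (λ lt → ℕ.≰⇒> λ j≤i → ℕ.<⇒≱ lt (Fin.punchIn-mono-≤ h j i j≤i))
  (λ lt → ℕ.≰⇒> λ j≤i → ℕ.<⇒≱ lt (Fin.punchIn-cancel-≤ h j i j≤i))

-- For a first entry `h` that is not extreme, this lemma and the next place the least and the
-- greatest of the other values on either side of `h`.
punchIn-zero< : {h : Fin (suc (suc n))} → h ≢ zero → punchIn h zero < h
punchIn-zero< {h = zero}  h≢0 = contradiction refl h≢0
punchIn-zero< {h = suc h} _   = s≤s z≤n

punchIn-fromℕ> : ∀ {n} {h : Fin (suc (suc n))} → h ≢ fromℕ (suc n) → h < punchIn h (fromℕ n)
punchIn-fromℕ> {n}     {zero}     _   = s≤s z≤n
punchIn-fromℕ> {zero}  {suc zero} h≢  = contradiction refl h≢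
punchIn-fromℕ> {suc n} {suc h}    h≢  = s≤s (punchIn-fromℕ> (h≢ ∘ cong suc))

punchIn-fromℕ< : (j : Fin n) → punchIn (fromℕ n) j < fromℕ n
punchIn-fromℕ< zero    = s≤s z≤n
punchIn-fromℕ< (suc j) = s≤s (punchIn-fromℕ< j)

pivot<?punchIn : ∀ b (j : Fin n) → does (pivot {n} b Fin.<? punchIn (pivot b) j) ≡ b
pivot<?punchIn {n} true j = dec-true (zero {n} Fin.<? suc j) (s≤s z≤n)
pivot<?punchIn false j = dec-false (fromℕ _ Fin.<? punchIn (fromℕ _) j) (ℕ.<⇒≯ (punchIn-fromℕ< j))

punchIn<?pivot : ∀ b (j : Fin n) → does (punchIn (pivot b) j Fin.<? pivot {n} b) ≡ not b
punchIn<?pivot {n} true j = dec-false (suc j Fin.<? zero {n}) (λ ())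
punchIn<?pivot false j = dec-true (punchIn (fromℕ _) j Fin.<? fromℕ _) (punchIn-fromℕ< j)

-- The indices `j` and `k` are not ordered, so a single condition covers both patterns.
NoSplit : Vec (Fin n) k → Set
NoSplit v = ∀ {i j k} → i < j → i < k →
  lookup v j < lookup v i → ¬ (lookup v i < lookup v k)

noSplit-tail : ∀ {h} {v : Vec (Fin n) k} → NoSplit (h ∷ v) → NoSplit v
noSplit-tail ns i<j i<k = ns (s≤s i<j) (s≤s i<k)

module _ {f : Fin m → Fin n} (f-< : ∀ {i j} → (f i < f j) ⇔ (i < j)) where

  lookup-map-< : (v : Vec (Fin m) k) → ∀ i j →
                 (lookup (map f v) i < lookup (map f v) j) ⇔ (lookup v i < lookup v j)
  lookup-map-< v i j rewrite lookup-map i f v | lookup-map j f v = f-<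

  ascents-map : (v : Vec (Fin m) (suc k)) → ascents (map f v) ≡ ascents v
  ascents-map v = tabulate-cong λ i →
    does-⇔ (lookup-map-< v (inject₁ i) (suc i)) (_ Fin.<? _) (_ Fin.<? _)

  descents-map : (v : Vec (Fin m) (suc k)) → descents (map f v) ≡ descents v
  descents-map v = tabulate-cong λ i →
    does-⇔ (lookup-map-< v (suc i) (inject₁ i)) (_ Fin.<? _) (_ Fin.<? _)

  noSplit-map⁺ : (v : Vec (Fin m) k) → NoSplit v → NoSplit (map f v)
  noSplit-map⁺ v ns {i} {j} {k} i<j i<k j< <k = ns i<j i<k
    (Equivalence.to (lookup-map-< v j i) j<) (Equivalence.to (lookup-map-< v i k) <k)

  noSplit-map⁻ : (v : Vec (Fin m) k) → NoSplit (map f v) → NoSplit v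
  noSplit-map⁻ v ns {i} {j} {k} i<j i<k j< <k = ns i<j i<k
    (Equivalence.from (lookup-map-< v j i) j<) (Equivalence.from (lookup-map-< v i k) <k)

-- The pivot compares in the same way with every later entry, which gives the first letter;
-- `punchIn` preserves order, so the tail keeps its ascents.
ascents-fromWord : (w : Vec Bool n) → ascents (fromWord w) ≡ w
ascents-fromWord []      = refl
ascents-fromWord (b ∷ w) = cong₂ _∷_
  (trans (cong (λ j → does (pivot b Fin.<? j)) (lookup-map zero _ (fromWord w)))
         (pivot<?punchIn b _))
  (trans (ascents-map (punchIn-< (pivot b)) (fromWord w)) (ascents-fromWord w))

descents-fromWord : (w : Vec Bool n) → descents (fromWord w) ≡ ∁ w
descents-fromWord []      = refl
descents-fromWord (b ∷ w) = cong₂ _∷_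
  (trans (cong (λ j → does (j Fin.<? pivot b)) (lookup-map zero _ (fromWord w)))
         (punchIn<?pivot b _))
  (trans (descents-map (punchIn-< (pivot b)) (fromWord w)) (descents-fromWord w))

-- `ascents` is a left inverse of `fromWord`.
fromWord-injective : {v w : Vec Bool n} → fromWord v ≡ fromWord w → v ≡ w
fromWord-injective {v = v} {w} eq =
  trans (sym (ascents-fromWord v)) (trans (cong ascents eq) (ascents-fromWord w))

noSplit-fromWord : (w : Vec Bool n) → NoSplit (fromWord w)
noSplit-fromWord []      {zero} {zero} ()
noSplit-fromWord (b ∷ w) {zero} {suc j} {suc k} _ _ j< <k
  rewrite lookup-map j (punchIn (pivot b)) (fromWord w)
        | lookup-map k (punchIn (pivot b)) (fromWord w)
  with b
-- Nothing lies below the minimum, and in the other case nothing lies above the maximum.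
... | true  with () ← j<
... | false = ℕ.<⇒≯ (punchIn-fromℕ< (lookup (fromWord w) k)) <k
noSplit-fromWord (b ∷ w) {suc i} {suc j} {suc k} (s≤s i<j) (s≤s i<k) =
  noSplit-map⁺ (punchIn-< (pivot b)) (fromWord w) (noSplit-fromWord w) i<j i<k

unique-fromWord : (w : Vec Bool n) → Unique (fromWord w)
unique-fromWord []      = [] ∷ []
unique-fromWord (b ∷ w) =
  All.map⁺ (All.universal (λ j eq → Fin.punchInᵢ≢i (pivot b) j (sym eq)) (fromWord w)) ∷
  Unique.map⁺ (Fin.punchIn-injective (pivot b) _ _) (unique-fromWord w)

fromWord-contains : ∀ c (w : Vec Bool n) → ∃ λ j → lookup (fromWord w) j ≡ pivot c
fromWord-contains true  []          = zero , refl
fromWord-contains false []          = zero , refl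
fromWord-contains true  (true ∷ w)  = zero , refl
fromWord-contains false (false ∷ w) = zero , refl
fromWord-contains true  (false ∷ w) with j , eq ← fromWord-contains true w =
  suc j , trans (lookup-map j _ (fromWord w)) (cong (punchIn (fromℕ _)) eq)
fromWord-contains false (true ∷ w)  with j , eq ← fromWord-contains false w =
  suc j , trans (lookup-map j _ (fromWord w)) (cong suc eq)

punchOut-all : ∀ {h : Fin (suc n)} {v : Vec _ k} → All (h ≢_) v → ∃ λ u → v ≡ map (punchIn h) u
punchOut-all []           = [] , refl
punchOut-all (h≢ ∷ h≢v) with u , refl ← punchOut-all h≢v =
  punchOut h≢ ∷ u , cong (_∷ _) (sym (Fin.punchIn-punchOut h≢))

unique-map⁻ : ∀ {f : Fin m → Fin n} {v : Vec _ k} → Unique (map f v) → Unique v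
unique-map⁻ {v = []}    []         = []
unique-map⁻ {v = a ∷ v} (a∉ ∷ v!) =
  All.map (λ fa≢ eq → fa≢ (cong _ eq)) (All.map⁻ a∉) ∷ unique-map⁻ v!

-- Induction on the length: the tail, with the value `h` punched out, again has distinct entries and
-- no split, so it comes from a word. It remains to see that `h` is extreme.
noSplit⇒fromWord : (π : Vec (Fin (suc n)) (suc n)) → Unique π → NoSplit π →
                   ∃ λ w → π ≡ fromWord w
noSplit⇒fromWord {zero}  (zero ∷ []) _ _ = [] , refl
noSplit⇒fromWord {suc n} (h ∷ t) (h∉ ∷ t!) ns
  with t′ , refl ← punchOut-all h∉
  with w , refl ← noSplit⇒fromWord t′ (unique-map⁻ t!)
                    (noSplit-map⁻ (punchIn-< h) t′ (noSplit-tail {h = h} ns))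
  with h Fin.≟ zero | h Fin.≟ fromℕ (suc n)
... | yes refl | _        = true ∷ w , refl
... | no _     | yes refl = false ∷ w , refl
-- Otherwise the entries of the tail that come from its least and greatest values split `h`.
... | no h≢0   | no h≢max
  with j , j-min ← fromWord-contains true w
     | k , k-max ← fromWord-contains false w =
  contradiction
    (subst (h <_) (sym (trans (lookup-map k _ (fromWord w)) (cong (punchIn h) k-max)))
           (punchIn-fromℕ> h≢max))
    (ns {zero} {suc j} {suc k} (s≤s z≤n) (s≤s z≤n)
      (subst (_< h) (sym (trans (lookup-map j _ (fromWord w)) (cong (punchIn h) j-min)))
             (punchIn-zero< h≢0)))

-- Splits and pattern occurrences

noSplit⇒avoids₂₁₃ : (π : Vec (Fin n) n) → NoSplit π → Avoids π τ₂₁₃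
noSplit⇒avoids₂₁₃ π ns (i , i-< , π≅τ) =
  ns (i-< 0F 1F (s≤s z≤n)) (i-< 0F 2F (s≤s z≤n))
     (Equivalence.from (π≅τ 1F 0F) (s≤s z≤n)) (Equivalence.from (π≅τ 0F 2F) (s≤s (s≤s z≤n)))

noSplit⇒avoids₂₃₁ : (π : Vec (Fin n) n) → NoSplit π → Avoids π τ₂₃₁
noSplit⇒avoids₂₃₁ π ns (i , i-< , π≅τ) =
  ns (i-< 0F 2F (s≤s z≤n)) (i-< 0F 1F (s≤s z≤n))
     (Equivalence.from (π≅τ 2F 0F) (s≤s z≤n)) (Equivalence.from (π≅τ 0F 1F) (s≤s (s≤s z≤n)))

increasing : ∀ {i j k : Fin n} → i < j → j < k → let v = i ∷ j ∷ k ∷ [] in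
             ∀ a b → a < b → lookup v a < lookup v b
increasing i<j j<k 0F 1F _ = i<j
increasing i<j j<k 0F 2F _ = ℕ.<-trans i<j j<k
increasing i<j j<k 1F 2F _ = j<k
increasing i<j j<k 1F 1F (s≤s ())
increasing i<j j<k 2F 1F (s≤s ())
increasing i<j j<k 2F 2F (s≤s (s≤s ()))

-- The converse follows by trichotomy on the letters of `τ`: a reversed inequality contradicts
-- `mono`, and equal letters of a word with distinct letters sit at the same index.
monotone⇒⇔ : ∀ {f : Fin m → Fin n} {τ : Vec (Fin k) m} → Unique τ →
             (∀ a b → lookup τ a < lookup τ b → f a < f b) →
             ∀ a b → (f a < f b) ⇔ (lookup τ a < lookup τ b)
monotone⇒⇔ {f = f} {τ} τ! mono a b = mk⇔ reflects (mono a b)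
  where
  reflects : f a < f b → lookup τ a < lookup τ b
  reflects fa<fb with Fin.<-cmp (lookup τ a) (lookup τ b)
  ... | tri< lt _ _ = lt
  ... | tri> _ _ gt = contradiction (mono b a gt) (ℕ.<⇒≯ fa<fb)
  ... | tri≈ _ eq _ =
    contradiction fa<fb (ℕ.<-irrefl (cong (toℕ ∘ f) (Unique.lookup-injective τ! a b eq)))

-- Both patterns begin with their middle value. A split is a 213 if the smaller entry comes first
-- and a 231 if the larger one does.
avoids⇒noSplit : (π : Vec (Fin n) n) → Avoids π τ₂₁₃ → Avoids π τ₂₃₁ → NoSplit π
avoids⇒noSplit π av₂₁₃ av₂₃₁ {i} {j} {k} i<j i<k j< <k with Fin.<-cmp j k
... | tri≈ _ refl _ = ℕ.<⇒≯ j< <k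
... | tri< j<k _ _  = av₂₁₃ (i ∷ j ∷ k ∷ [] , increasing i<j j<k , monotone⇒⇔ τ! mono)
  where
  τ! : Unique τ₂₁₃
  τ! = ((λ ()) ∷ (λ ()) ∷ []) ∷ ((λ ()) ∷ []) ∷ [] ∷ []
  mono : ∀ a b → lookup τ₂₁₃ a < lookup τ₂₁₃ b →
         lookup π (lookup (i ∷ j ∷ k ∷ []) a) < lookup π (lookup (i ∷ j ∷ k ∷ []) b)
  mono 0F 2F _ = <k
  mono 1F 0F _ = j<
  mono 1F 2F _ = ℕ.<-trans j< <k
  mono 0F 0F (s≤s ())
  mono 2F 0F (s≤s ())
  mono 2F 2F (s≤s (s≤s ()))
... | tri> _ _ k<j  = av₂₃₁ (i ∷ k ∷ j ∷ [] , increasing i<k k<j , monotone⇒⇔ τ! mono)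
  where
  τ! : Unique τ₂₃₁
  τ! = ((λ ()) ∷ (λ ()) ∷ []) ∷ ((λ ()) ∷ []) ∷ [] ∷ []
  mono : ∀ a b → lookup τ₂₃₁ a < lookup τ₂₃₁ b →
         lookup π (lookup (i ∷ k ∷ j ∷ []) a) < lookup π (lookup (i ∷ k ∷ j ∷ []) b)
  mono 0F 1F _ = <k
  mono 2F 0F _ = j<
  mono 2F 1F _ = ℕ.<-trans j< <k
  mono 0F 0F (s≤s ())
  mono 1F 0F (s≤s ())
  mono 1F 1F (s≤s (s≤s ()))
  mono _  2F ()

module _ {k l} (τ : Vec (Fin k) k) (ρ : Vec (Fin l) l) where

  private
    -- These restate the tests inside `S` and `permutations`, so that the filter lemmas can name
    -- them.
    avoidsBoth? : (π : Vec (Fin n) n) → Dec (Avoids π τ × Avoids π ρ)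
    avoidsBoth? π = avoids? π τ ×-dec avoids? π ρ

    unique? : (π : Vec (Fin n) n) → Dec (Unique π)
    unique? = allPairs? λ i j → ¬? (i Fin.≟ j)

  ∈-S⁺ : {π : Vec (Fin n) n} → Unique π → Avoids π τ → Avoids π ρ → π List.∈ S n τ ρ
  ∈-S⁺ {n} {π} π! avτ avρ =
    ∈-filter⁺ avoidsBoth? {xs = permutations n}
      (∈-filter⁺ unique? (∈-words ∈-allFin π) π!) (avτ , avρ)

  ∈-S⁻ : {π : Vec (Fin n) n} → π List.∈ S n τ ρ → Unique π × Avoids π τ × Avoids π ρ
  ∈-S⁻ {n} π∈ with π∈perms , av ← ∈-filter⁻ avoidsBoth? {xs = permutations n} π∈ =
    proj₂ (∈-filter⁻ unique? {xs = words (List.allFin n) n} π∈perms) , av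

  S-unique : ∀ n → List.Unique (S n τ ρ)
  S-unique n = List.filter⁺ avoidsBoth?
    (List.filter⁺ unique? (words-unique (List.allFin⁺ n) n))

fromWord∈S : (w : Vec Bool n) → fromWord w List.∈ S (suc n) τ₂₁₃ τ₂₃₁
fromWord∈S w = ∈-S⁺ τ₂₁₃ τ₂₃₁ (unique-fromWord w)
  (noSplit⇒avoids₂₁₃ (fromWord w) (noSplit-fromWord w))
  (noSplit⇒avoids₂₃₁ (fromWord w) (noSplit-fromWord w))

∈S⇒fromWord : (π : Vec (Fin (suc n)) (suc n)) → π List.∈ S (suc n) τ₂₁₃ τ₂₃₁ →
              ∃ λ w → π ≡ fromWord w
∈S⇒fromWord π π∈ =
  let π! , av₂₁₃ , av₂₃₁ = ∈-S⁻ τ₂₁₃ τ₂₃₁ π∈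
  in noSplit⇒fromWord π π! (avoids⇒noSplit π av₂₁₃ av₂₃₁)

-- Transporting with subst, since matching on the equations makes Agda normalise S.
words↭S : ∀ n → List.map fromWord (words bools n) ↭ S (suc n) τ₂₁₃ τ₂₃₁
words↭S n = ∼bag⇒↭ (unique∧set⇒bag
  (List.map⁺ fromWord-injective (words-unique bools-unique n))
  (S-unique τ₂₁₃ τ₂₃₁ (suc n))
  (mk⇔
    (λ π∈ → let w , _ , π≡ = ∈-map⁻ fromWord π∈ in
      subst (List._∈ S (suc n) τ₂₁₃ τ₂₃₁) (sym π≡) (fromWord∈S w))
    (λ π∈ → let w , π≡ = ∈S⇒fromWord _ π∈ in
      subst (List._∈ List.map fromWord (words bools n)) (sym π≡)
        (∈-map⁺ fromWord (∈-words ∈-bools w)))))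

-- Assembling the generating function

private module R = CommutativeRing ℤ⟦p,q,y,z⟧
open PowerSeries ℤ⟦p,q,y,z⟧ using (coeff; mk≋; X; _⊠_)
module W = WordSeries ℤ⟦p,q,y,z⟧ Coefficients.p Coefficients.q Coefficients.y Coefficients.z
open Exp R.semiring using () renaming (_^_ to _^ᴿ_)

weight-fromWord : ∀ {n} (w : Vec Bool n) → Coefficients.weight (fromWord w) ≡ W.wordWeight w
weight-fromWord w = trans
  (cong₂ (monomial (asc π) (des π))
    (maxNonOverlapping≡greedy (ascents π)) (maxNonOverlapping≡greedy (descents π)))
  (cong₂ (λ J K → monomial (∣ J ∣) (∣ K ∣) (greedy J) (greedy K))
    (ascents-fromWord w) (descents-fromWord w))
  where
  π : Vec (Fin _) _
  π = fromWord w

  -- With the exponents as arguments, both rewritings of the weight are plain congruences.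
  monomial : ℕ → ℕ → ℕ → ℕ → R.Carrier
  monomial a d i j =
    Coefficients.p ^ᴿ a R.* Coefficients.q ^ᴿ d R.* Coefficients.y ^ᴿ i R.* Coefficients.z ^ᴿ j

-- The empty permutation gives `1#`. A permutation of length `suc n` corresponds to a word of length
-- `n`, which accounts for the factor `x`.
G≈1+xF : G τ₂₁₃ τ₂₃₁ ≈ 1# + x * W.allWords
G≈1+xF = mk≋ λ where
    zero → constant-term
    (suc n) → begin
      ∑-list ℤ⟦p,q,y,z⟧ (S (suc n) τ₂₁₃ τ₂₃₁) Coefficients.weight
        ≈⟨ ∑-↭ ℤ⟦p,q,y,z⟧ (words↭S n) ⟨
      ∑-list ℤ⟦p,q,y,z⟧ (List.map fromWord (words bools n)) Coefficients.weight
        ≈⟨ ∑-map ℤ⟦p,q,y,z⟧ fromWord (words bools n) ⟩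
      ∑-list ℤ⟦p,q,y,z⟧ (words bools n) (λ w → Coefficients.weight (fromWord w))
        ≈⟨ ∑-cong ℤ⟦p,q,y,z⟧ (words bools n) (λ w → R.reflexive (weight-fromWord w)) ⟩
      coeff W.allWords n
        ≈⟨ X⊠-suc ℤ⟦p,q,y,z⟧ W.allWords n ⟨
      coeff (X ⊠ W.allWords) (suc n)
        ≈⟨ R.+-identityˡ _ ⟨
      coeff (1# + x * W.allWords) (suc n)
        ∎
  where
  open import Relation.Binary.Reasoning.Setoid R.setoid
  constant-term : coeff (G τ₂₁₃ τ₂₃₁) 0 R.≈ coeff (1# + x * W.allWords) 0
  constant-term = begin
    R.1# R.* R.1# R.* R.1# R.* R.1# R.+ R.0#  ≈⟨ R.+-identityʳ _ ⟩
    R.1# R.* R.1# R.* R.1# R.* R.1#           ≈⟨ R.*-identityʳ _ ⟩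
    R.1# R.* R.1# R.* R.1#                    ≈⟨ R.*-identityʳ _ ⟩
    R.1# R.* R.1#                             ≈⟨ R.*-identityʳ _ ⟩
    R.1#                                      ≈⟨ R.+-identityʳ _ ⟨
    R.1# R.+ R.0#                             ≈⟨ R.+-congˡ (X⊠-zero ℤ⟦p,q,y,z⟧ W.allWords) ⟨
    coeff (1# + x * W.allWords) 0             ∎

theorem8 : G τ₂₁₃ τ₂₃₁
    ≈ (1# + x + p * x ^ 2 * y - p ^ 2 * x ^ 2 * y + q * x ^ 2 * z - q ^ 2 * x ^ 2 * z
    - p * q * x ^ 2 * y * z + p * q * x ^ 3 * y * z
    - p ^ 2 * q * x ^ 3 * y * z - p * q ^ 2 * x ^ 3 * y * z)
    / (1# - p ^ 2 * x ^ 2 * y - q ^ 2 * x ^ 2 * z - p * q * x ^ 2 * y * z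
    - p ^ 2 * q * x ^ 3 * y * z - p * q ^ 2 * x ^ 3 * y * z)
-- Here `B` and `C` are the series of words starting with an ascent and with a descent.
theorem8 = quotient ℤ⟦p,q,y,z,x⟧ x p q y z
  W.allWords≈ (W.wordsFrom≈ true) (W.wordsFrom≈ false)
  G≈1+xF
  (geometric≈ ℤ⟦p,q,y,z⟧ Coefficients.p Coefficients.y)
  (geometric≈ ℤ⟦p,q,y,z⟧ Coefficients.q Coefficients.z)
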